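{- Let $G=(V,E,c)$ be an undirected weighted graph with an edge $\{b,d\}\in E$, and let $G^\ominus$, with cost function $c^\ominus$, be obtained from $G$ by decreasing the cost of $\{b,d\}$ or by deleting $\{b,d\}$. Let $(X,V\setminus X)$ denote a minimum $x$-$y$-cut in $G$ with $x\in X$, $y\in V\setminus X$ and $\{b,d\}\subseteq V\setminus X$. Let further $(U,V\setminus U)$ denote a cut that separates $b$ and $d$. (i) If $(U,V\setminus U)$ separates $x$ and $y$ with $x\in U$, then $c^\ominus(U\cup X, V\setminus(U\cup X))\le c^\ominus(U,V\setminus U)$. (ii) If $(U,V\setminus U)$ does not separate $x$ and $y$, with $x\in V\setminus U$, then $c^\ominus(U\setminus X, V\setminus(U\setminus X))\le c^\ominus(U,V\setminus U)$.
   Context: $G=(V,E,c)$ is a finite undirected graph with positive edge costs $c$. A cut is a partition of $V$ into two nonempty cut sides $S$ and $V\setminus S$; its cost $c(S,V\setminus S)$ is the sum of the costs of all edges with one endpoint in each side. A cut separates two vertices if they lie on different cut sides. A minimum $x$-$y$-cut is a cut of minimum cost among all cuts separating $x$ and $y$. $G^\ominus$ is the graph on $V$ resulting from $G$ when the cost of $\{b,d\}$ is decreased by some $\Delta>0$ (to a positive value) or $\{b,d\}$ with $c(b,d)=\Delta>0$ is deleted; all other edges and costs are unchanged. $c^\ominus$ denotes edge costs and cut costs in $G^\ominus$. -}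

module Defs where

open import Level using (Level; suc; _⊔_; 0ℓ)
open import Algebra.Bundles using (AbelianGroup; CommutativeMonoid)
open import Algebra.Structures using (IsAbelianGroup)
import Algebra.Properties.CommutativeMonoid.Sum as Summation
open import Data.Bool using (if_then_else_)
open import Data.Fin using (Fin)
open import Data.Fin.Subset using (Subset; _∈_; ∁; Nonempty)
open import Data.Fin.Subset.Properties using (_∈?_)
open import Data.Nat using (ℕ)
open import Data.Product using (_×_)
open import Data.Sum using (_⊎_)
open import Function.Bundles using (_⇔_)
open import Relation.Binary.Core using (Rel)
open import Relation.Binary.Definitions using (Symmetric; Irreflexive; Decidable)
open import Relation.Binary.PropositionalEquality using (_≡_)
open import Relation.Binary.Structures using (IsTotalOrder)
open import Relation.Nullary using (¬_; does)
open import Relation.Nullary.Decidable using (_×-dec_)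

-- Costs are only ever added, subtracted and compared, so they are taken in an
-- arbitrary totally ordered abelian group: ℤ, ℚ and (classically) ℝ are
-- instances.
record OrderedAbelianGroup (c ℓ₁ ℓ₂ : Level) : Set (suc (c ⊔ ℓ₁ ⊔ ℓ₂)) where
  infix  4 _≈_ _≤_ _<_
  infixl 6 _+_ _-_
  infix  8 -_
  field
    Carrier        : Set c
    _≈_            : Rel Carrier ℓ₁
    _≤_            : Rel Carrier ℓ₂
    _+_            : Carrier → Carrier → Carrier
    0#             : Carrier
    -_             : Carrier → Carrier
    isAbelianGroup : IsAbelianGroup _≈_ _+_ 0# -_
    isTotalOrder   : IsTotalOrder _≈_ _≤_
    +-monoˡ-≤      : ∀ z {x y} → x ≤ y → x + z ≤ y + z

  _<_ : Rel Carrier (ℓ₁ ⊔ ℓ₂)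
  x < y = x ≤ y × ¬ (x ≈ y)

  _-_ : Carrier → Carrier → Carrier
  x - y = x + (- y)

  abelianGroup : AbelianGroup c ℓ₁
  abelianGroup = record { isAbelianGroup = isAbelianGroup }

  commutativeMonoid : CommutativeMonoid c ℓ₁
  commutativeMonoid = AbelianGroup.commutativeMonoid abelianGroup

  open Summation commutativeMonoid public using (sum)

module _ {c ℓ₁ ℓ₂ : Level} (K : OrderedAbelianGroup c ℓ₁ ℓ₂) where

  open OrderedAbelianGroup K

  -- The value of edgeCost on a pair that is not an edge carries no meaning and
  -- never enters the cost of a cut.
  record WeightedGraph (n : ℕ) : Set (suc 0ℓ ⊔ c ⊔ ℓ₁ ⊔ ℓ₂) where
    field
      Edge         : Rel (Fin n) 0ℓ
      edge?        : Decidable Edge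
      edge-sym     : Symmetric Edge
      edge-irrefl  : Irreflexive _≡_ Edge
      edgeCost     : Fin n → Fin n → Carrier
      edgeCost-sym : ∀ {u v} → Edge u v → edgeCost u v ≈ edgeCost v u
      edgeCost-pos : ∀ {u v} → Edge u v → 0# < edgeCost u v

module _ {n : ℕ} where

  -- A subset S stands for the cut (S , ∁ S).
  IsCut : Subset n → Set
  IsCut S = Nonempty S × Nonempty (∁ S)

  Separates : Subset n → Fin n → Fin n → Set
  Separates S u v = (u ∈ S × v ∈ ∁ S) ⊎ (u ∈ ∁ S × v ∈ S)

  -- {u , v} = {b , d} as unordered pairs.
  SamePair : (u v b d : Fin n) → Set
  SamePair u v b d = (u ≡ b × v ≡ d) ⊎ (u ≡ d × v ≡ b)

module _ {c ℓ₁ ℓ₂ : Level} {K : OrderedAbelianGroup c ℓ₁ ℓ₂} {n : ℕ} where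

  open OrderedAbelianGroup K
  open WeightedGraph

  -- For disjoint S and T each edge between them is counted once, at the
  -- ordered pair (u , v) with u ∈ S and v ∈ T.
  cost : WeightedGraph K n → Subset n → Subset n → Carrier
  cost G S T = sum λ u → sum λ v →
    if does (u ∈? S ×-dec v ∈? T ×-dec edge? G u v) then edgeCost G u v else 0#

  IsMinimumCut : WeightedGraph K n → Fin n → Fin n → Subset n → Set ℓ₂
  IsMinimumCut G x y X =
    IsCut X × Separates X x y ×
    (∀ S → IsCut S → Separates S x y → cost G X (∁ X) ≤ cost G S (∁ S))

  -- Reduction G b d G⊖ : G⊖ results from G by lowering the cost of {b , d} by
  -- some Δ > 0, or by deleting {b , d}. In the first case the new cost is
  -- positive because {b , d} is still an edge of G⊖.
  data Reduction (G : WeightedGraph K n) (b d : Fin n) (G⊖ : WeightedGraph K n)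
       : Set (c ⊔ ℓ₁ ⊔ ℓ₂) where
    decrease :
      (Δ : Carrier) → 0# < Δ →
      (∀ u v → Edge G⊖ u v ⇔ Edge G u v) →
      edgeCost G⊖ b d ≈ edgeCost G b d - Δ →
      (∀ u v → Edge G u v → ¬ SamePair u v b d → edgeCost G⊖ u v ≈ edgeCost G u v) →
      Reduction G b d G⊖
    delete :
      (∀ u v → Edge G⊖ u v ⇔ (Edge G u v × ¬ SamePair u v b d)) →
      (∀ u v → Edge G u v → ¬ SamePair u v b d → edgeCost G⊖ u v ≈ edgeCost G u v) →
      Reduction G b d G⊖

{-# OPTIONS --safe #-}
-- The cut function is submodular, so c⊖(U ∪ X) + c⊖(U ∩ X) ≤ c⊖(U) + c⊖(X).
-- Neither X nor U ∩ X contains b or d, hence c⊖ agrees with c on both of them.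
-- If x ∈ U, then U ∩ X separates x and y, so c(X) ≤ c(U ∩ X) by minimality of
-- X, and (i) follows by cancellation. Part (ii) is (i) for the cut side ∁ U,
-- since ∁ U ∪ X is the complement of U ─ X.
module Submission where

open import Defs
open import Level using (Level)
open import Algebra.Bundles using (AbelianGroup)
import Algebra.Properties.CommutativeMonoid.Sum as Summation
open import Data.Bool using (Bool; true; false; _∧_; _∨_; not; if_then_else_)
open import Data.Bool.Properties using (if-∧)
open import Data.Fin using (Fin; zero; suc)
open import Data.Fin.Subset using (Subset; _∈_; _∉_; ∁; _∪_; _∩_; _─_; _⊆_)
open import Data.Fin.Subset.Properties
  using (_∈?_; p∩q⊆q; x∈p∩q⁺; x∈∁p⇒x∉p; x∉p⇒x∈∁p)
open import Data.Nat using (ℕ; zero; suc)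
open import Data.Product using (_×_; _,_; proj₁; proj₂)
open import Data.Sum using (inj₁; inj₂)
open import Data.Vec using ([]; _∷_; lookup)
open import Data.Vec.Properties using (lookup-map; lookup-zipWith; lookup⇒[]=)
open import Function using (_∘_)
open import Function.Bundles using (_⇔_; mk⇔; Equivalence)
open import Relation.Binary.Bundles using (Poset)
import Relation.Binary.Reasoning.PartialOrder as PartialOrderReasoning
open import Relation.Binary.PropositionalEquality as ≡ using (_≡_; cong)
open import Relation.Binary.Structures using (IsTotalOrder)
open import Relation.Nullary using (¬_; does; yes; no; contradiction)

-- Subsets as Boolean vectors.

does-∈? : ∀ {n} (u : Fin n) (S : Subset n) → does (u ∈? S) ≡ lookup S u
does-∈? zero    (true  ∷ S) = ≡.refl
does-∈? zero    (false ∷ S) = ≡.refl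
does-∈? (suc u) (_     ∷ S) = does-∈? u S

-- De Morgan's law, with the difference read as an intersection with `∁ q`. It turns the difference
-- in part (ii) into a union.
∁p∪q≡∁[p─q] : ∀ {n} (p q : Subset n) → ∁ p ∪ q ≡ ∁ (p ─ q)
∁p∪q≡∁[p─q] []          []          = ≡.refl
∁p∪q≡∁[p─q] (true  ∷ p) (true  ∷ q) = cong (true  ∷_) (∁p∪q≡∁[p─q] p q)
∁p∪q≡∁[p─q] (true  ∷ p) (false ∷ q) = cong (false ∷_) (∁p∪q≡∁[p─q] p q)
∁p∪q≡∁[p─q] (false ∷ p) (true  ∷ q) = cong (true  ∷_) (∁p∪q≡∁[p─q] p q)
∁p∪q≡∁[p─q] (false ∷ p) (false ∷ q) = cong (true  ∷_) (∁p∪q≡∁[p─q] p q)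

-- Inequalities in ordered abelian groups.

module OrderedAbelianGroupProperties
  {c ℓ₁ ℓ₂ : Level} (K : OrderedAbelianGroup c ℓ₁ ℓ₂) where

  open OrderedAbelianGroup K
  open AbelianGroup abelianGroup public
    using (refl; sym; trans; reflexive)
    renaming ( comm to +-comm; assoc to +-assoc; ∙-cong to +-cong
             ; ∙-congˡ to +-congˡ; identityʳ to +-identityʳ; inverseʳ to +-inverseʳ)
  open IsTotalOrder isTotalOrder public
    using () renaming (reflexive to ≤-reflexive; refl to ≤-refl)
  open Summation commutativeMonoid public using (∑-distrib-+; ∑-comm; sum-cong-≋)

  ≤-poset : Poset c ℓ₁ ℓ₂
  ≤-poset = record { isPartialOrder = IsTotalOrder.isPartialOrder isTotalOrder }

  open PartialOrderReasoning ≤-poset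

  +-mono-≤ : ∀ {p q r s} → p ≤ q → r ≤ s → p + r ≤ q + s
  +-mono-≤ {p} {q} {r} {s} p≤q r≤s = begin
    p + r  ≤⟨ +-monoˡ-≤ r p≤q ⟩
    q + r  ≈⟨ +-comm q r ⟩
    r + q  ≤⟨ +-monoˡ-≤ q r≤s ⟩
    s + q  ≈⟨ +-comm s q ⟩
    q + s  ∎

  +-cancelʳ-≤ : ∀ r {p q} → p + r ≤ q + r → p ≤ q
  +-cancelʳ-≤ r {p} {q} p+r≤q+r = begin
    p              ≈⟨ cancel p ⟨
    p + r + (- r)  ≤⟨ +-monoˡ-≤ (- r) p+r≤q+r ⟩
    q + r + (- r)  ≈⟨ cancel q ⟩
    q              ∎
    where
    cancel : ∀ z → z + r + (- r) ≈ z
    cancel z = trans (+-assoc z r (- r)) (trans (+-congˡ (+-inverseʳ r)) (+-identityʳ z))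

  sum-mono-≤ : ∀ {n} {f g : Fin n → Carrier} → (∀ i → f i ≤ g i) → sum f ≤ sum g
  sum-mono-≤ {zero} f≤g = ≤-refl
  sum-mono-≤ {suc n}  f≤g = +-mono-≤ (f≤g zero) (sum-mono-≤ (f≤g ∘ suc))

-- Cut functions of arbitrary weights on ordered pairs.

module CutFunction
  {c ℓ₁ ℓ₂ : Level} (K : OrderedAbelianGroup c ℓ₁ ℓ₂) {n : ℕ} where

  open OrderedAbelianGroup K
  open OrderedAbelianGroupProperties K
  open PartialOrderReasoning ≤-poset

  sum²-cong : {f g : Fin n → Fin n → Carrier} → (∀ u v → f u v ≈ g u v) →
              sum (λ u → sum (f u)) ≈ sum (λ u → sum (g u))
  sum²-cong f≈g = sum-cong-≋ λ u → sum-cong-≋ (f≈g u)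

  sum²-distrib-+ : (f g : Fin n → Fin n → Carrier) →
    sum (λ u → sum λ v → f u v + g u v) ≈ sum (λ u → sum (f u)) + sum (λ u → sum (g u))
  sum²-distrib-+ f g =
    trans (sum-cong-≋ λ u → ∑-distrib-+ (f u) (g u))
          (∑-distrib-+ (λ u → sum (f u)) (λ u → sum (g u)))

  -- Membership enters as two Booleans, so that claims about a single ordered pair become finite
  -- case distinctions.
  crossing : Carrier → (s t : Bool) → Carrier
  crossing w s t = if s ∧ not t then w else 0#

  cut : (Fin n → Fin n → Carrier) → Subset n → Carrier
  cut w S = sum λ u → sum λ v → crossing (w u v) (lookup S u) (lookup S v)

  -- The sides differ only if one set contains just the first endpoint and the other just the
  -- second: then the right side is `w` and the left side vanishes. In all other cases they agree up
  -- to the order of the summands.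
  crossing-submodular : ∀ {w} → 0# ≤ w → ∀ s s′ t t′ →
    crossing w (s ∨ s′) (t ∨ t′) + crossing w (s ∧ s′) (t ∧ t′) ≤
    crossing w s t + crossing w s′ t′
  crossing-submodular 0≤w false false _     _     = ≤-refl
  crossing-submodular 0≤w true  true  true  _     = ≤-refl
  crossing-submodular 0≤w true  true  false _     = ≤-reflexive (+-comm _ _)
  crossing-submodular 0≤w true  false true  _     = ≤-refl
  crossing-submodular 0≤w true  false false true  = +-mono-≤ 0≤w ≤-refl
  crossing-submodular 0≤w true  false false false = ≤-refl
  crossing-submodular 0≤w false true  true  true  = ≤-refl
  crossing-submodular 0≤w false true  true  false = +-mono-≤ ≤-refl 0≤w
  crossing-submodular 0≤w false true  false _     = ≤-reflexive (+-comm _ _)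

  cut-submodular : ∀ {w} → (∀ u v → 0# ≤ w u v) → (S T : Subset n) →
                   cut w (S ∪ T) + cut w (S ∩ T) ≤ cut w S + cut w T
  cut-submodular {w} 0≤w S T = begin
    cut w (S ∪ T) + cut w (S ∩ T)                   ≈⟨ sum²-distrib-+ (cr (S ∪ T)) (cr (S ∩ T)) ⟨
    sum (λ u → sum λ v → cr (S ∪ T) u v + cr (S ∩ T) u v)
      ≤⟨ (sum-mono-≤ λ u → sum-mono-≤ λ v → pointwise u v) ⟩
    sum (λ u → sum λ v → cr S u v + cr T u v)       ≈⟨ sum²-distrib-+ (cr S) (cr T) ⟩
    cut w S + cut w T                               ∎
    where
    cr : Subset n → Fin n → Fin n → Carrier
    cr R u v = crossing (w u v) (lookup R u) (lookup R v)

    pointwise : ∀ u v → cr (S ∪ T) u v + cr (S ∩ T) u v ≤ cr S u v + cr T u v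
    pointwise u v
      rewrite lookup-zipWith _∨_ u S T | lookup-zipWith _∨_ v S T
            | lookup-zipWith _∧_ u S T | lookup-zipWith _∧_ v S T
      = crossing-submodular (0≤w u v) (lookup S u) (lookup T u) (lookup S v) (lookup T v)

  crossing-not : ∀ {w w′} → w ≈ w′ → ∀ s t → crossing w (not s) (not t) ≈ crossing w′ t s
  crossing-not w≈w′ true  true  = refl
  crossing-not w≈w′ true  false = refl
  crossing-not w≈w′ false true  = w≈w′
  crossing-not w≈w′ false false = refl

  -- A pair leaves `∁ S` exactly when the reversed pair leaves `S`. Symmetry of `w` reverses its
  -- arguments, and exchanging the two sums restores the order of summation.
  cut-∁ : ∀ {w} → (∀ u v → w u v ≈ w v u) → (S : Subset n) → cut w (∁ S) ≈ cut w S
  cut-∁ {w} w-sym S =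
    trans (sum²-cong pointwise)
          (∑-comm λ u v → crossing (w v u) (lookup S v) (lookup S u))
    where
    pointwise : ∀ u v → crossing (w u v) (lookup (∁ S) u) (lookup (∁ S) v) ≈
                        crossing (w v u) (lookup S v) (lookup S u)
    pointwise u v rewrite lookup-map u not S | lookup-map v not S =
      crossing-not (w-sym u v) (lookup S u) (lookup S v)

  -- Pairs that do not leave `S` contribute `0#` under either weight, so agreement is required only
  -- on pairs that do. This lets the two weights differ at an edge that the cut does not cross.
  cut-cong : ∀ {w w′} (S : Subset n) →
             (∀ {u v} → u ∈ S → v ∉ S → w u v ≈ w′ u v) → cut w S ≈ cut w′ S
  cut-cong {w} {w′} S w≈w′ = sum²-cong pointwise
    where
    pointwise : ∀ u v → crossing (w u v) (lookup S u) (lookup S v) ≈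
                        crossing (w′ u v) (lookup S u) (lookup S v)
    pointwise u v with lookup S u in Su | lookup S v in Sv
    ... | false | _     = refl
    ... | true  | true  = refl
    ... | true  | false = w≈w′ (lookup⇒[]= u S Su) v∉S
      where
      v∉S : v ∉ S
      v∉S = x∈∁p⇒x∉p (lookup⇒[]= v (∁ S) (≡.trans (lookup-map v not S) (cong not Sv)))

-- Costs of cuts in a graph and in its reduction.

module _ {c ℓ₁ ℓ₂ : Level} {K : OrderedAbelianGroup c ℓ₁ ℓ₂} {n : ℕ} where

  open OrderedAbelianGroup K
  open OrderedAbelianGroupProperties K
  open CutFunction K {n}
  open PartialOrderReasoning ≤-poset
  open WeightedGraph

  -- Extension of the edge costs by `0#`: `edgeCost` is arbitrary off the edges, whereas `weight` is
  -- nonnegative and symmetric on all pairs.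
  weight : WeightedGraph K n → Fin n → Fin n → Carrier
  weight G u v = if does (edge? G u v) then edgeCost G u v else 0#

  weight-nonneg : ∀ G u v → 0# ≤ weight G u v
  weight-nonneg G u v with edge? G u v
  ... | yes e = proj₁ (edgeCost-pos G e)
  ... | no  _ = ≤-refl

  -- Allowing two graphs and two pairs covers both the symmetry of one graph and the comparison of a
  -- graph with its reduction. Costs are compared only in the presence of an edge, since elsewhere
  -- both weights are `0#`.
  weight-cong : ∀ G H {u v u′ v′} → Edge G u v ⇔ Edge H u′ v′ →
                (Edge H u′ v′ → edgeCost G u v ≈ edgeCost H u′ v′) →
                weight G u v ≈ weight H u′ v′
  weight-cong G H {u} {v} {u′} {v′} G⇔H G≈H with edge? G u v | edge? H u′ v′
  ... | yes _ | yes e = G≈H e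
  ... | no  _ | no  _ = refl
  ... | yes e | no ¬e = contradiction (Equivalence.to G⇔H e) ¬e
  ... | no ¬e | yes e = contradiction (Equivalence.from G⇔H e) ¬e

  weight-sym : ∀ G u v → weight G u v ≈ weight G v u
  weight-sym G u v =
    weight-cong G G (mk⇔ (edge-sym G) (edge-sym G)) (sym ∘ edgeCost-sym G)

  cost≈cut : ∀ G S → cost G S (∁ S) ≈ cut (weight G) S
  cost≈cut G S = sum²-cong λ u v → reflexive (pointwise u v)
    where
    pointwise : ∀ u v →
      (if does (u ∈? S) ∧ does (v ∈? ∁ S) ∧ does (edge? G u v) then edgeCost G u v else 0#)
      ≡ crossing (weight G u v) (lookup S u) (lookup S v)
    pointwise u v
      rewrite does-∈? u S | does-∈? v (∁ S) | lookup-map v not S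
      with lookup S u
    ... | false = ≡.refl
    -- With `u` in `S`, the remaining conjunction splits into nested conditionals, the inner one
    -- being `weight G u v`.
    ... | true  = if-∧ (not (lookup S v))

  cost-∁ : ∀ G S → cost G (∁ S) (∁ (∁ S)) ≈ cost G S (∁ S)
  cost-∁ G S =
    trans (cost≈cut G (∁ S)) (trans (cut-∁ (weight-sym G) S) (sym (cost≈cut G S)))

  cost-submodular : ∀ G S T →
    cost G (S ∪ T) (∁ (S ∪ T)) + cost G (S ∩ T) (∁ (S ∩ T)) ≤ cost G S (∁ S) + cost G T (∁ T)
  cost-submodular G S T = begin
    cost G (S ∪ T) (∁ (S ∪ T)) + cost G (S ∩ T) (∁ (S ∩ T))
      ≈⟨ +-cong (cost≈cut G (S ∪ T)) (cost≈cut G (S ∩ T)) ⟩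
    cut (weight G) (S ∪ T) + cut (weight G) (S ∩ T)
      ≤⟨ cut-submodular (weight-nonneg G) S T ⟩
    cut (weight G) S + cut (weight G) T
      ≈⟨ +-cong (cost≈cut G S) (cost≈cut G T) ⟨
    cost G S (∁ S) + cost G T (∁ T) ∎

  -- Away from the pair of `b` and `d`, lowering and deleting alike preserve both the edges and
  -- their costs.
  weight-reduction : ∀ {G G⊖ b d u v} → Reduction G b d G⊖ → ¬ SamePair u v b d →
                     weight G⊖ u v ≈ weight G u v
  weight-reduction {G} {G⊖} {u = u} {v} (decrease _ _ edges _ costs) ≢bd =
    weight-cong G⊖ G (edges u v) (λ e → costs u v e ≢bd)
  weight-reduction {G} {G⊖} {u = u} {v} (delete edges costs) ≢bd =
    weight-cong G⊖ G
      (mk⇔ (proj₁ ∘ Equivalence.to (edges u v))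
           (λ e → Equivalence.from (edges u v) (e , ≢bd)))
      (λ e → costs u v e ≢bd)

  module _ {G G⊖ : WeightedGraph K n} {b d : Fin n} (reduction : Reduction G b d G⊖) where

    cost-reduction : ∀ {S} → b ∉ S → d ∉ S → cost G⊖ S (∁ S) ≈ cost G S (∁ S)
    cost-reduction {S} b∉S d∉S =
      trans (cost≈cut G⊖ S) (trans (cut-cong S agree) (sym (cost≈cut G S)))
      where
      agree : ∀ {u v} → u ∈ S → v ∉ S → weight G⊖ u v ≈ weight G u v
      -- The first endpoint lies in `S`, so it is neither `b` nor `d`, which excludes both
      -- orientations of the altered edge.
      agree u∈S _ = weight-reduction reduction λ where
        (inj₁ (≡.refl , _)) → b∉S u∈S
        (inj₂ (≡.refl , _)) → d∉S u∈S

    module _ {x y : Fin n} {X : Subset n} (minimum : IsMinimumCut G x y X)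
             (x∈X : x ∈ X) (y∉X : y ∉ X) (b∉X : b ∉ X) (d∉X : d ∉ X) where

      cost-∪-minimumCut : ∀ {U} → x ∈ U → cost G⊖ (U ∪ X) (∁ (U ∪ X)) ≤ cost G⊖ U (∁ U)
      cost-∪-minimumCut {U} x∈U = +-cancelʳ-≤ (cost G⊖ (U ∩ X) (∁ (U ∩ X))) (begin
        cost G⊖ (U ∪ X) (∁ (U ∪ X)) + cost G⊖ (U ∩ X) (∁ (U ∩ X))
          ≤⟨ cost-submodular G⊖ U X ⟩
        cost G⊖ U (∁ U) + cost G⊖ X (∁ X)
          -- Puts the cost of `U ∩ X` on both sides, ready for cancellation.
          ≤⟨ +-mono-≤ ≤-refl X≤U∩X ⟩
        cost G⊖ U (∁ U) + cost G⊖ (U ∩ X) (∁ (U ∩ X)) ∎)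
        where
        U∩X⊆X : U ∩ X ⊆ X
        U∩X⊆X = p∩q⊆q U X

        x∈U∩X : x ∈ U ∩ X
        x∈U∩X = x∈p∩q⁺ (x∈U , x∈X)

        y∈∁[U∩X] : y ∈ ∁ (U ∩ X)
        y∈∁[U∩X] = x∉p⇒x∈∁p (y∉X ∘ U∩X⊆X)

        X≤U∩X : cost G⊖ X (∁ X) ≤ cost G⊖ (U ∩ X) (∁ (U ∩ X))
        X≤U∩X = begin
          cost G⊖ X (∁ X)
            ≈⟨ cost-reduction b∉X d∉X ⟩
          cost G X (∁ X)
            -- Minimality is available only in `G`, hence the detour through its costs. The vertices
            -- `x` and `y` witness both that the two sides of `U ∩ X` are nonempty and that they are
            -- separated.
            ≤⟨ proj₂ (proj₂ minimum) (U ∩ X)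
                 ((x , x∈U∩X) , (y , y∈∁[U∩X])) (inj₁ (x∈U∩X , y∈∁[U∩X])) ⟩
          cost G (U ∩ X) (∁ (U ∩ X))
            ≈⟨ cost-reduction (b∉X ∘ U∩X⊆X) (d∉X ∘ U∩X⊆X) ⟨
          cost G⊖ (U ∩ X) (∁ (U ∩ X)) ∎

      cost-─-minimumCut : ∀ {U} → x ∈ ∁ U → cost G⊖ (U ─ X) (∁ (U ─ X)) ≤ cost G⊖ U (∁ U)
      cost-─-minimumCut {U} x∈∁U = begin
        cost G⊖ (U ─ X) (∁ (U ─ X))          ≈⟨ cost-∁ G⊖ (U ─ X) ⟨
        cost G⊖ (∁ (U ─ X)) (∁ (∁ (U ─ X)))  ≡⟨ cong (λ S → cost G⊖ S (∁ S)) (∁p∪q≡∁[p─q] U X) ⟨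
        -- Part (i) applies to `∁ U` because this is the side containing `x`.
        cost G⊖ (∁ U ∪ X) (∁ (∁ U ∪ X))      ≤⟨ cost-∪-minimumCut x∈∁U ⟩
        cost G⊖ (∁ U) (∁ (∁ U))              ≈⟨ cost-∁ G⊖ U ⟩
        cost G⊖ U (∁ U)                      ∎

theorem2 : ∀ {c ℓ₁ ℓ₂ : Level} (K : OrderedAbelianGroup c ℓ₁ ℓ₂) (n : ℕ)
    (G G⊖ : WeightedGraph K n) (b d : Fin n) →
    WeightedGraph.Edge G b d →
    Reduction G b d G⊖ →
    (x y : Fin n) (X : Subset n) →
    IsMinimumCut G x y X →
    x ∈ X → y ∈ ∁ X →
    b ∈ ∁ X → d ∈ ∁ X →
    (U : Subset n) → IsCut U → Separates U b d →
    let open OrderedAbelianGroup K using (_≤_) in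
    (Separates U x y → x ∈ U →
    cost G⊖ (U ∪ X) (∁ (U ∪ X)) ≤ cost G⊖ U (∁ U))
    ×
    (¬ Separates U x y → x ∈ ∁ U →
    cost G⊖ (U ─ X) (∁ (U ─ X)) ≤ cost G⊖ U (∁ U))
theorem2 K n G G⊖ b d _ reduction x y X minimum x∈X y∈∁X b∈∁X d∈∁X U _ _ =
  (λ _ → cost-∪-minimumCut reduction minimum x∈X y∉X b∉X d∉X) ,
  (λ _ → cost-─-minimumCut reduction minimum x∈X y∉X b∉X d∉X)
  where
  y∉X : y ∉ X
  y∉X = x∈∁p⇒x∉p y∈∁X

  b∉X : b ∉ X
  b∉X = x∈∁p⇒x∉p b∈∁X

  d∉X : d ∉ X
  d∉X = x∈∁p⇒x∉p d∈∁X
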